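{- Let $r,s$ be relations in $\mathcal R$, and let $c_1,c_2$ be functions from $\mathit{Heap}$ to $(\mathit{Heap}+\{\mathit{err}\})_\bot$ (elements of the FM-cpo $\mathit{Heap}\to(\mathit{Heap}+\{\mathit{err}\})_\bot$). The quadruple $[r](\mathsf{cps}(c_1),\mathsf{cps}(c_2))[s]$ holds if and only if for all $r'\in\mathcal R$ and all $h_1,h_2\in\mathit{Heap}$, $$h_1[r*r']h_2\implies\bigl(c_1(h_1)=c_2(h_2)=\bot\ \vee\ c_1(h_1)\,[(s*r')^{\bot\bot}]\,c_2(h_2)\bigr).$$
   Context: **FM domain theory.** $\mathit{Loc}$ is a countably infinite set. A permutation is a bijection $\pi$ of $\mathit{Loc}$ with $\pi(l)\neq l$ for only finitely many $l$. An FM-set is a set $A$ with an action of permutations ($\mathrm{id}\cdot a=a$, $\pi\cdot(\pi'\cdot a)=(\pi\circ\pi')\cdot a$) such that every $a\in A$ is supported by some finite $L\subseteq\mathit{Loc}$, i.e. ($\forall l\in L.\ \pi(l)=l$) implies $\pi\cdot a=a$. An FM-poset is an FM-set with a partial order preserved by the action; an FM-cpo is an FM-poset in which every $\omega$-chain whose elements are all supported by one common finite set has a least upper bound. The function space $A\to B$ (also written $[A\to B]$) of FM-cpos consists of the finitely supported (for $(\pi\cdot f)(a)=\pi\cdot f(\pi^{ -1}\cdot a)$) monotone functions preserving lubs of finitely supported chains. **Semantic domains.** $\mathit{Val}=\mathit{Loc}+\mathit{Int}+\{\mathit{default}\}$ (discrete; $\pi$ acts on locations only). $\mathit{O}=\{\mathit{normal},\mathit{err}\}_\bot$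 (flat, trivial action), $\mathit{G}=\{\mathit{normal},\bot\}\subseteq\mathit O$. $\mathit{Heap}$ is the (discretely ordered) FM-cpo of finite partial functions from $\mathit{Loc}$ to $\mathit{Val}\times\mathit{Val}$, with $(\pi\cdot h)(l)=\pi\cdot h(\pi^{ -1}(l))$ for $l\in\pi(\mathrm{dom}\,h)$. $\mathit{Cont}=(\mathit{Heap}\to\mathit{O})$. $h\bullet h'$ is the union of $h$ and $h'$, defined only when their domains are disjoint. **Relations and quadruples.** $\mathcal R$ is the set of finitely supported binary relations $r$ on $\mathit{Heap}$ (for some finite $L\subseteq\mathit{Loc}$, every $\pi$ fixing $L$ pointwise satisfies $h_0[r]h_1\iff(\pi\cdot h_0)[r](\pi\cdot h_1)$). $h_0[r*s]h_1$ iff there are splittings $h_0=n_0\bullet m_0$, $h_1=n_1\bullet m_1$ with $n_0[r]n_1$ and $m_0[s]m_1$. $\mathsf{eq}(D_0)=\{(d,d)\mid d\in D_0\}$. $k_0[r\to\mathsf{eq}(\mathit{G})]k_1$ means $k_0(h_0)[\mathsf{eq}(\mathit{G})]k_1(h_1)$ whenever $h_0[r]h_1$. For $d_0,d_1\in(\mathit{Heap}\times\mathit{Cont}\to\mathit{O})$ and $r,s\in\mathcal R$, the semantic quadruple $[r](d_0,d_1)[s]$ holds iff for all $r'\in\mathcal R$, $h_0,h_1\in\mathit{Heap}$, $k_0,k_1\in\mathit{Cont}$: $h_0[r*r']h_1$ and $k_0[s*r'\to\mathsf{eq}(\mathit{G})]k_1$ imply $d_0(h_0,k_0)[\mathsf{eq}(\mathit{G})]d_1(h_1,k_1)$.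 **CPS transform.** $\mathsf{cps}:(\mathit{Heap}\to(\mathit{Heap}+\{\mathit{err}\})_\bot)\to(\mathit{Heap}\times\mathit{Cont}\to\mathit{O})$ is given by $\mathsf{cps}(c)(h,k)=k(c(h))$ if $c(h)\notin\{\bot,\mathit{err}\}$, and $\mathsf{cps}(c)(h,k)=c(h)$ otherwise. **Observation closure.** For an FM-cpo $D$ and a relation $r\subseteq D\times D$, the relation $r^\bot$ on $[D\to\mathit{O}]$ and the relation $r^{\bot\bot}$ on $D$ are: $k_1[r^\bot]k_2$ iff for all $d_1,d_2\in D$, $d_1[r]d_2$ implies $k_1(d_1)[\mathsf{eq}(\mathit G)]k_2(d_2)$; and $d_1[r^{\bot\bot}]d_2$ iff for all $k_1,k_2\in[D\to\mathit{O}]$, $k_1[r^\bot]k_2$ implies $k_1(d_1)[\mathsf{eq}(\mathit G)]k_2(d_2)$. Here it is used with $D=\mathit{Heap}$; in particular $c_1(h_1)[(s*r')^{\bot\bot}]c_2(h_2)$ entails that $c_1(h_1)$ and $c_2(h_2)$ are both in $\mathit{Heap}$. -}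

module Defs where

open import Axiom.ExcludedMiddle using (ExcludedMiddle)
open import Data.Empty using (⊥-elim)
open import Data.Integer.Base using (ℤ)
import Data.Integer.Properties as ℤ
open import Data.List.Base using (List; []; _∷_; _++_; map; concatMap)
open import Data.List.Membership.Propositional using (_∈_; _∉_; lose)
open import Data.List.Membership.Propositional.Properties
  using (∈-map⁺; ∈-++⁺ˡ; ∈-++⁺ʳ; ∈-concatMap⁺)
open import Data.List.Relation.Unary.Any using (here; there)
import Data.List.Relation.Unary.Any as Any
import Data.List.Relation.Unary.All as All
open import Data.Maybe.Base as Maybe using (Maybe; just; nothing; _<∣>_)
open import Data.Maybe.Properties using (just-injective)
import Data.Maybe.Properties as Maybe
open import Data.Nat.Base using (ℕ; zero; suc; _+_)
import Data.Nat.Properties as ℕ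
open import Data.Product.Base as Product using (∃-syntax; _×_; _,_; proj₁; proj₂)
import Data.Product.Properties as Product
open import Data.Product.Relation.Binary.Pointwise.NonDependent
  using (×-setoid; ×-isPartialOrder)
open import Data.Sum.Base as Sum using (_⊎_; inj₁; inj₂)
open import Data.Sum.Relation.Binary.Pointwise using (⊎-setoid; inj₁; inj₂)
open import Function.Base using (_∘_; id)
open import Function.Bundles using (_↔_; _⇔_; Inverse; mk↔ₛ′)
open import Function.Construct.Composition using (_↔-∘_)
open import Function.Construct.Identity using (↔-id)
open import Function.Construct.Symmetry using (↔-sym)
open import Function.Properties.Inverse using (↔⇒↣)
open import Level using (0ℓ)
open import Relation.Binary.Bundles using (Setoid)
open import Relation.Binary.Core using (Rel)
open import Relation.Binary.Definitions using (DecidableEquality; _Respects₂_)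
open import Relation.Binary.PropositionalEquality
  using (_≡_; _≢_)
import Relation.Binary.PropositionalEquality as ≡
open import Relation.Binary.Structures using (IsPartialOrder)
open import Relation.Nullary.Construct.Add.Infimum using (_₋; ⊥₋; [_])
open import Relation.Nullary.Decidable.Core using (Dec; yes; no; map′; decidable-stable)
open import Relation.Nullary.Decidable using (via-injection)
open import Relation.Nullary.Negation.Core using (¬_)
open import Relation.Unary using (Pred)
import Relation.Binary.Construct.Add.Infimum.Equality as LiftEq
import Relation.Binary.Construct.Add.Infimum.NonStrict as LiftOrd
import Relation.Binary.Properties.Setoid as SetoidProperties

module Semantics (Loc : Set) (Loc↔ℕ : Loc ↔ ℕ) where

  _≟ₗ_ : DecidableEquality Loc
  _≟ₗ_ = via-injection (↔⇒↣ Loc↔ℕ) ℕ._≟_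

  infixr 9 _∘ₚ_
  infix  4 _≈ₚ_

  record Perm : Set where
    field
      bijection : Loc ↔ Loc
    open Inverse bijection public using (to; from; strictlyInverseˡ; strictlyInverseʳ)
    field
      finite    : ∃[ L ] ∀ l → to l ≢ l → l ∈ L

  open Perm using (to; from)

  _≈ₚ_ : Rel Perm 0ℓ
  π ≈ₚ σ = ∀ l → to π l ≡ to σ l

  Fixes : Perm → List Loc → Set
  Fixes π L = ∀ {l} → l ∈ L → to π l ≡ l

  idₚ : Perm
  idₚ = record { bijection = ↔-id Loc ; finite = [] , λ l l≢l → ⊥-elim (l≢l ≡.refl) }

  _∘ₚ_ : Perm → Perm → Perm
  π ∘ₚ σ = record
    { bijection = Perm.bijection π ↔-∘ Perm.bijection σ
    ; finite    = proj₁ (Perm.finite π) ++ proj₁ (Perm.finite σ) , moved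
    }
    where
    moved : ∀ l → to π (to σ l) ≢ l → l ∈ proj₁ (Perm.finite π) ++ proj₁ (Perm.finite σ)
    moved l ne with to σ l ≟ₗ l
    ... | yes eq = ∈-++⁺ˡ (proj₂ (Perm.finite π) l (λ πl≡l → ne (≡.trans (≡.cong (to π) eq) πl≡l)))
    ... | no neq = ∈-++⁺ʳ (proj₁ (Perm.finite π)) (proj₂ (Perm.finite σ) l neq)

  infix 10 _⁻¹

  _⁻¹ : Perm → Perm
  π ⁻¹ = record
    { bijection = ↔-sym (Perm.bijection π)
    ; finite    = proj₁ (Perm.finite π) , λ l ne → proj₂ (Perm.finite π) l
        (λ πl≡l → ne (≡.trans (≡.cong (from π) (≡.sym πl≡l)) (Perm.strictlyInverseʳ π l)))
    }

  from-cong : ∀ {π σ} → π ≈ₚ σ → π ⁻¹ ≈ₚ σ ⁻¹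
  from-cong {π} {σ} eq l = ≡.trans (≡.cong (from π) (≡.sym (Perm.strictlyInverseˡ σ l)))
    (≡.trans (≡.cong (from π) (≡.sym (eq (from σ l)))) (Perm.strictlyInverseʳ π (from σ l)))

  Fixes-⁻¹ : ∀ π {L} → Fixes π L → Fixes (π ⁻¹) L
  Fixes-⁻¹ π fix {l} l∈L = ≡.trans (≡.cong (from π) (≡.sym (fix l∈L))) (Perm.strictlyInverseʳ π l)

  -- Sets are setoids, so an action also has to respect the extensional equality of
  -- permutations and the equality of elements.
  record FMSet : Set₁ where
    infixr 8 _·_
    field
      setoid′ : Setoid 0ℓ 0ℓ
    open Setoid setoid′ public
    field
      _·_     : Perm → Carrier → Carrier
      ·-cong  : ∀ {π σ a b} → π ≈ₚ σ → a ≈ b → π · a ≈ σ · b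
      ·-id    : ∀ a → idₚ · a ≈ a
      ·-∘     : ∀ π σ a → π · σ · a ≈ (π ∘ₚ σ) · a

    Supports : List Loc → Carrier → Set
    Supports L a = ∀ π → Fixes π L → π · a ≈ a

    field
      supported : ∀ a → ∃[ L ] Supports L a

    ·-inverseʳ : ∀ π a → π · π ⁻¹ · a ≈ a
    ·-inverseʳ π a = trans (·-∘ π (π ⁻¹) a)
      (trans (·-cong (Perm.strictlyInverseˡ π) refl) (·-id a))

    ·-inverseˡ : ∀ π a → π ⁻¹ · π · a ≈ a
    ·-inverseˡ π a = trans (·-∘ (π ⁻¹) π a)
      (trans (·-cong (Perm.strictlyInverseʳ π) refl) (·-id a))

    Supports-resp : ∀ {L a b} → a ≈ b → Supports L a → Supports L b
    Supports-resp a≈b sup π fix = trans (·-cong (λ _ → ≡.refl) (sym a≈b)) (trans (sup π fix) a≈b)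

    Supports-⊆ : ∀ {L M a} → (∀ {l} → l ∈ L → l ∈ M) → Supports L a → Supports M a
    Supports-⊆ L⊆M sup π fix = sup π (fix ∘ L⊆M)

    Supports-· : ∀ {L a} π → Supports L a → Supports (map (to π) L) (π · a)
    Supports-· {L} {a} π sup σ fix =
      trans (sym (·-inverseʳ π (σ · π · a)))
        (·-cong (λ _ → ≡.refl)
          (trans (·-cong (λ _ → ≡.refl) (·-∘ σ π a))
            (trans (·-∘ (π ⁻¹) (σ ∘ₚ π) a)
              (sup (π ⁻¹ ∘ₚ (σ ∘ₚ π)) λ {l} l∈L →
                ≡.trans (≡.cong (from π) (fix (∈-map⁺ (to π) l∈L))) (Perm.strictlyInverseʳ π l)))))

  record FMPoset : Set₁ where
    field
      fmSet          : FMSet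
    open FMSet fmSet public
    infix 4 _≤_
    field
      _≤_            : Rel Carrier 0ℓ
      isPartialOrder : IsPartialOrder _≈_ _≤_
      ·-mono         : ∀ π {a b} → a ≤ b → π · a ≤ π · b
    open IsPartialOrder isPartialOrder public using (antisym)
      renaming (refl to ≤-refl; reflexive to ≤-reflexive; trans to ≤-trans)

    record Chain : Set where
      field
        seq       : ℕ → Carrier
        ascending : ∀ n → seq n ≤ seq (suc n)
        support   : ∃[ L ] ∀ n → Supports L (seq n)

    IsLub : (ℕ → Carrier) → Carrier → Set
    IsLub c a = (∀ n → c n ≤ a) × (∀ b → (∀ n → c n ≤ b) → a ≤ b)

    IsLub-unique : ∀ {c a b} → IsLub c a → IsLub c b → a ≈ b
    IsLub-unique (a-ub , a-least) (b-ub , b-least) = antisym (a-least _ b-ub) (b-least _ a-ub)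

  -- Even the chains of the flat domain {normal, err}_⊥ have least upper bounds only
  -- classically: one has to decide whether a chain ever leaves ⊥.  Completeness is therefore
  -- asserted under excluded middle; classically this is exactly the notion of FM-cpo.
  record FMCpo : Set₁ where
    field
      fmPoset : FMPoset
    open FMPoset fmPoset public
    field
      lub : ExcludedMiddle 0ℓ → (c : Chain) → ∃[ a ] IsLub (Chain.seq c) a

  ∣_∣ : FMCpo → Set
  ∣ A ∣ = FMCpo.Carrier A

  discrete : FMSet → FMCpo
  discrete A = record
    { fmPoset = record
      { fmSet          = A
      ; _≤_            = A._≈_
      ; isPartialOrder = SetoidProperties.≈-isPartialOrder A.setoid′
      ; ·-mono         = λ π → A.·-cong (λ _ → ≡.refl)
      }
    ; lub = λ _ c → let module c = FMPoset.Chain c in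
        c.seq 0 , (constant c.seq c.ascending , λ b ub → ub 0)
    }
    where
    module A = FMSet A
    constant : ∀ c → (∀ n → c n A.≈ c (suc n)) → ∀ n → c n A.≈ c 0
    constant c asc zero    = A.refl
    constant c asc (suc n) = A.trans (A.sym (asc n)) (constant c asc n)

  infixr 6 _⊎ᶠᵐ_

  _⊎ᶠᵐ_ : FMSet → FMSet → FMSet
  A ⊎ᶠᵐ B = record
    { setoid′   = ⊎-setoid A.setoid′ B.setoid′
    ; _·_       = λ π → Sum.map (π A.·_) (π B.·_)
    ; ·-cong    = λ { π≈σ (inj₁ eq) → inj₁ (A.·-cong π≈σ eq)
                    ; π≈σ (inj₂ eq) → inj₂ (B.·-cong π≈σ eq) }
    ; ·-id      = λ { (inj₁ a) → inj₁ (A.·-id a) ; (inj₂ b) → inj₂ (B.·-id b) }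
    ; ·-∘       = λ { π σ (inj₁ a) → inj₁ (A.·-∘ π σ a) ; π σ (inj₂ b) → inj₂ (B.·-∘ π σ b) }
    ; supported = λ { (inj₁ a) → Product.map id (λ sup π fix → inj₁ (sup π fix)) (A.supported a)
                    ; (inj₂ b) → Product.map id (λ sup π fix → inj₂ (sup π fix)) (B.supported b) }
    }
    where
    module A = FMSet A
    module B = FMSet B

  trivialAction : Set → FMSet
  trivialAction A = record
    { setoid′   = ≡.setoid A
    ; _·_       = λ _ a → a
    ; ·-cong    = λ _ eq → eq
    ; ·-id      = λ _ → ≡.refl
    ; ·-∘       = λ _ _ _ → ≡.refl
    ; supported = λ _ → [] , λ _ _ → ≡.refl
    }

  infix 9 _⊥

  _⊥ : FMCpo → FMCpo
  A ⊥ = record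
    { fmPoset = record
      { fmSet = record
        { setoid′   = record { isEquivalence = ≈₋-isEquivalence A.isEquivalence }
        ; _·_       = act
        ; ·-cong    = λ { π≈σ ⊥₋≈⊥₋ → ⊥₋≈⊥₋ ; π≈σ [ eq ] → [ A.·-cong π≈σ eq ] }
        ; ·-id      = λ { ⊥₋ → ⊥₋≈⊥₋ ; [ a ] → [ A.·-id a ] }
        ; ·-∘       = λ { π σ ⊥₋ → ⊥₋≈⊥₋ ; π σ [ a ] → [ A.·-∘ π σ a ] }
        ; supported = λ { ⊥₋ → [] , λ _ _ → ⊥₋≈⊥₋
                        ; [ a ] → Product.map id (λ sup π fix → [ sup π fix ]) (A.supported a) }
        }
      ; _≤_            = _≤₋_
      ; isPartialOrder = ≤₋-isPartialOrder A.isPartialOrder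
      ; ·-mono         = λ { π (⊥₋≤ _) → ⊥₋≤ _ ; π [ le ] → [ A.·-mono π le ] }
      }
    ; lub = λ em c → let module c = FMPoset.Chain c in
        lub₋ c.seq c.ascending (proj₁ c.support) (proj₂ c.support) em
    }
    where
    module A = FMCpo A
    open LiftEq A._≈_
    open LiftOrd A._≤_

    act : Perm → A.Carrier ₋ → A.Carrier ₋
    act π ⊥₋    = ⊥₋
    act π [ a ] = [ π A.· a ]

    above : ∀ {d x} → [ d ] ≤₋ x → ∃[ e ] (x ≡ [ e ])
    above {x = [ e ]} [ _ ] = e , ≡.refl

    module _ (c : ℕ → A.Carrier ₋) (asc : ∀ n → c n ≤₋ c (suc n)) where

      asc-+ : ∀ n m → c n ≤₋ c (m + n)
      asc-+ n zero    = ≤₋-reflexive A.≤-reflexive (≈₋-refl A.refl)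
      asc-+ n (suc m) = ≤₋-trans A.≤-trans (asc-+ n m) (asc (m + n))

      IsLub₋ : A.Carrier ₋ → Set
      IsLub₋ x = (∀ n → c n ≤₋ x) × (∀ y → (∀ n → c n ≤₋ y) → x ≤₋ y)

      lub₋ : ∀ L → (∀ n π → Fixes π L → act π (c n) ≈₋ c n) →
             ExcludedMiddle 0ℓ → ∃[ x ] IsLub₋ x
      lub₋ L sup em with em {∃[ n ] ∃[ a ] (c n ≡ [ a ])}
      ... | no always⊥ = ⊥₋ , isBottom , λ y _ → ⊥₋≤ y
        where
        isBottom : ∀ n → c n ≤₋ ⊥₋
        isBottom n with c n in eq
        ... | ⊥₋    = ⊥₋≤ ⊥₋
        ... | [ a ] = ⊥-elim (always⊥ (n , a , eq))
      ... | yes (n , a , cn≡a) = [ proj₁ l ] , bound , least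
        where
        tail : ∀ m → ∃[ e ] (c (m + n) ≡ [ e ])
        tail m = above (≡.subst (_≤₋ c (m + n)) cn≡a (asc-+ n m))

        tail-asc : ∀ m → proj₁ (tail m) A.≤ proj₁ (tail (suc m))
        tail-asc m = [≤]-injective (≡.subst (_≤₋ [ proj₁ (tail (suc m)) ]) (proj₂ (tail m))
          (≡.subst (c (m + n) ≤₋_) (proj₂ (tail (suc m))) (asc (m + n))))

        tail-sup : ∀ m → A.Supports L (proj₁ (tail m))
        tail-sup m π fix = [≈]-injective
          (≡.subst (λ x → act π x ≈₋ x) (proj₂ (tail m)) (sup (m + n) π fix))

        l = A.lub em (record { seq = proj₁ ∘ tail ; ascending = tail-asc ; support = L , tail-sup })

        bound : ∀ m → c m ≤₋ [ proj₁ l ]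
        bound m = ≤₋-trans A.≤-trans
          (≡.subst (λ k → c m ≤₋ c k) (ℕ.+-comm n m) (asc-+ m n))
          (≡.subst (_≤₋ [ proj₁ l ]) (≡.sym (proj₂ (tail m))) [ proj₁ (proj₂ l) m ])

        least : ∀ y → (∀ m → c m ≤₋ y) → [ proj₁ l ] ≤₋ y
        least y ub with above (≡.subst (_≤₋ y) cn≡a (ub n))
        ... | e , ≡.refl = [ proj₂ (proj₂ l) e
          (λ m → [≤]-injective (≡.subst (_≤₋ [ e ]) (proj₂ (tail m)) (ub (m + n)))) ]

  infixr 5 _×ᶠᵐ_

  _×ᶠᵐ_ : FMCpo → FMCpo → FMCpo
  A ×ᶠᵐ B = record
    { fmPoset = record
      { fmSet = record
        { setoid′   = ×-setoid A.setoid′ B.setoid′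
        ; _·_       = λ π → Product.map (π A.·_) (π B.·_)
        ; ·-cong    = λ π≈σ → Product.map (A.·-cong π≈σ) (B.·-cong π≈σ)
        ; ·-id      = λ (a , b) → A.·-id a , B.·-id b
        ; ·-∘       = λ π σ (a , b) → A.·-∘ π σ a , B.·-∘ π σ b
        ; supported = λ (a , b) → let L , supᵃ = A.supported a ; M , supᵇ = B.supported b in
            L ++ M , λ π fix → supᵃ π (fix ∘ ∈-++⁺ˡ) , supᵇ π (fix ∘ ∈-++⁺ʳ L)
        }
      ; _≤_            = λ (a , b) (a′ , b′) → (a A.≤ a′) × (b B.≤ b′)
      ; isPartialOrder = ×-isPartialOrder A.isPartialOrder B.isPartialOrder
      ; ·-mono         = λ π → Product.map (A.·-mono π) (B.·-mono π)
      }
    ; lub = λ em c →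
        let module c = FMPoset.Chain c
            a , a-ub , a-least = A.lub em (record
              { seq       = proj₁ ∘ c.seq
              ; ascending = proj₁ ∘ c.ascending
              ; support   = Product.map id (λ sup n π fix → proj₁ (sup n π fix)) c.support })
            b , b-ub , b-least = B.lub em (record
              { seq       = proj₂ ∘ c.seq
              ; ascending = proj₂ ∘ c.ascending
              ; support   = Product.map id (λ sup n π fix → proj₂ (sup n π fix)) c.support })
        in (a , b) , (λ n → a-ub n , b-ub n) ,
           λ (a′ , b′) ub → a-least a′ (proj₁ ∘ ub) , b-least b′ (proj₂ ∘ ub)
    }
    where
    module A = FMCpo A
    module B = FMCpo B

  record Fun (A B : FMCpo) : Set where
    private
      module A = FMCpo A
      module B = FMCpo B
    infix 10 _⟨$⟩_
    field
      _⟨$⟩_      : A.Carrier → B.Carrier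
      monotone   : ∀ {a b} → a A.≤ b → _⟨$⟩_ a B.≤ _⟨$⟩_ b
      support    : ∃[ L ] ∀ π → Fixes π L → ∀ a → π B.· _⟨$⟩_ (π ⁻¹ A.· a) B.≈ _⟨$⟩_ a
      continuous : (c : A.Chain) → ∀ {a} → A.IsLub (A.Chain.seq c) a →
                   B.IsLub (_⟨$⟩_ ∘ A.Chain.seq c) (_⟨$⟩_ a)

    fun-cong : ∀ {a b} → a A.≈ b → _⟨$⟩_ a B.≈ _⟨$⟩_ b
    fun-cong eq = B.antisym (monotone (A.≤-reflexive eq)) (monotone (A.≤-reflexive (A.sym eq)))

  open Fun public using (_⟨$⟩_)

  module _ (A B : FMCpo) where
    private
      module A = FMCpo A
      module B = FMCpo B

    infixr 8 _·ᶠ_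

    _·ᶠ_ : Perm → Fun A B → Fun A B
    π ·ᶠ f = record
      { _⟨$⟩_      = λ a → π B.· f ⟨$⟩ (π ⁻¹ A.· a)
      ; monotone   = λ le → B.·-mono π (f.monotone (A.·-mono (π ⁻¹) le))
      ; support    = map (to π) (proj₁ f.support) , λ σ fix a →
          let τ = π ⁻¹ ∘ₚ (σ ∘ₚ π)
              τ-fixes : Fixes τ (proj₁ f.support)
              τ-fixes = λ {l} l∈L →
                ≡.trans (≡.cong (from π) (fix (∈-map⁺ (to π) l∈L))) (Perm.strictlyInverseʳ π l)
              arg : π ⁻¹ A.· σ ⁻¹ A.· a A.≈ τ ⁻¹ A.· π ⁻¹ A.· a
              arg = A.trans (A.·-∘ (π ⁻¹) (σ ⁻¹) a) (A.trans
                (A.·-cong (λ l → ≡.cong (λ k → from π (from σ k)) (≡.sym (Perm.strictlyInverseˡ π l))) A.refl)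
                (A.sym (A.·-∘ (τ ⁻¹) (π ⁻¹) a)))
              body : ∀ b → σ B.· π B.· b B.≈ π B.· τ B.· b
              body = λ b → B.trans (B.·-∘ σ π b) (B.trans
                (B.·-cong (λ l → ≡.sym (Perm.strictlyInverseˡ π (to σ (to π l)))) B.refl)
                (B.sym (B.·-∘ π τ b)))
          in B.trans (body _) (B.·-cong (λ _ → ≡.refl)
               (B.trans (B.·-cong (λ _ → ≡.refl) (f.fun-cong arg)) (proj₂ f.support τ τ-fixes _)))
      ; continuous = λ c {a} isLub →
          let module c = A.Chain c
              ub , least = f.continuous (shift c) (shift-isLub c.seq isLub)
          in (λ n → B.·-mono π (ub n)) , λ b b-ub → B.≤-trans
               (B.·-mono π (least (π ⁻¹ B.· b) λ n →
                 B.≤-trans (B.≤-reflexive (B.sym (B.·-inverseˡ π _))) (B.·-mono (π ⁻¹) (b-ub n))))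
               (B.≤-reflexive (B.·-inverseʳ π b))
      }
      where
      module f = Fun f
      shift : A.Chain → A.Chain
      shift c = record
        { seq       = λ n → π ⁻¹ A.· c.seq n
        ; ascending = λ n → A.·-mono (π ⁻¹) (c.ascending n)
        ; support   = map (from π) (proj₁ c.support) , λ n → A.Supports-· (π ⁻¹) (proj₂ c.support n)
        }
        where module c = A.Chain c
      shift-isLub : ∀ c {a} → A.IsLub c a → A.IsLub (λ n → π ⁻¹ A.· c n) (π ⁻¹ A.· a)
      shift-isLub c (ub , least) = (λ n → A.·-mono (π ⁻¹) (ub n)) , λ b b-ub → A.≤-trans
        (A.·-mono (π ⁻¹) (least (π A.· b) λ n →
          A.≤-trans (A.≤-reflexive (A.sym (A.·-inverseʳ π (c n)))) (A.·-mono π (b-ub n))))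
        (A.≤-reflexive (A.·-inverseˡ π b))

    funPoset : FMPoset
    funPoset = record
      { fmSet = record
        { setoid′   = record
          { Carrier       = Fun A B
          ; _≈_           = λ f g → ∀ a → f ⟨$⟩ a B.≈ g ⟨$⟩ a
          ; isEquivalence = record
            { refl  = λ _ → B.refl
            ; sym   = λ eq a → B.sym (eq a)
            ; trans = λ eq eq′ a → B.trans (eq a) (eq′ a)
            }
          }
        ; _·_       = _·ᶠ_
        ; ·-cong    = λ {π} {σ} {f} π≈σ f≈g a → B.·-cong π≈σ
            (B.trans (Fun.fun-cong f (A.·-cong (from-cong {π} {σ} π≈σ) A.refl)) (f≈g _))
        ; ·-id      = λ f a → B.trans (B.·-id _) (Fun.fun-cong f
            (A.trans (A.·-cong (λ _ → ≡.refl) A.refl) (A.·-id a)))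
        ; ·-∘       = λ π σ f a → B.trans (B.·-∘ π σ _) (B.·-cong (λ _ → ≡.refl)
            (Fun.fun-cong f (A.trans (A.·-∘ (σ ⁻¹) (π ⁻¹) a) (A.·-cong (λ _ → ≡.refl) A.refl))))
        ; supported = Fun.support
        }
      ; _≤_            = λ f g → ∀ a → f ⟨$⟩ a B.≤ g ⟨$⟩ a
      ; isPartialOrder = record
        { isPreorder = record
          { isEquivalence = record
            { refl  = λ _ → B.refl
            ; sym   = λ eq a → B.sym (eq a)
            ; trans = λ eq eq′ a → B.trans (eq a) (eq′ a)
            }
          ; reflexive     = λ eq a → B.≤-reflexive (eq a)
          ; trans         = λ le le′ a → B.≤-trans (le a) (le′ a)
          }
        ; antisym    = λ le ge a → B.antisym (le a) (ge a)
        }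
      ; ·-mono         = λ π le a → B.·-mono π (le _)
      }

    module Limit (em : ExcludedMiddle 0ℓ) (c : FMPoset.Chain funPoset) where
      module c = FMPoset.Chain c
      L = proj₁ c.support

      at : A.Carrier → B.Chain
      at a = record
        { seq       = λ n → c.seq n ⟨$⟩ a
        ; ascending = λ n → c.ascending n a
        ; support   = L ++ proj₁ (A.supported a) , λ n π fix → B.trans
            (B.·-cong (λ _ → ≡.refl) (Fun.fun-cong (c.seq n) (A.sym
              (proj₂ (A.supported a) (π ⁻¹) (Fixes-⁻¹ π (fix ∘ ∈-++⁺ʳ L))))))
            (proj₂ c.support n π (fix ∘ ∈-++⁺ˡ) a)
        }

      value : A.Carrier → B.Carrier
      value a = proj₁ (B.lub em (at a))

      value-ub : ∀ a n → c.seq n ⟨$⟩ a B.≤ value a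
      value-ub a = proj₁ (proj₂ (B.lub em (at a)))

      value-least : ∀ a b → (∀ n → c.seq n ⟨$⟩ a B.≤ b) → value a B.≤ b
      value-least a = proj₂ (proj₂ (B.lub em (at a)))

      value-mono : ∀ {a b} → a A.≤ b → value a B.≤ value b
      value-mono {a} {b} le = value-least a _ λ n →
        B.≤-trans (Fun.monotone (c.seq n) le) (value-ub b n)

      value-below : ∀ π → Fixes π L → ∀ a → π B.· value (π ⁻¹ A.· a) B.≤ value a
      value-below π fix a = B.≤-trans
        (B.·-mono π (value-least _ (π ⁻¹ B.· value a) λ n → B.≤-trans
          (B.≤-reflexive (B.trans (B.sym (B.·-inverseˡ π _))
            (B.·-cong (λ _ → ≡.refl) (proj₂ c.support n π fix a))))
          (B.·-mono (π ⁻¹) (value-ub a n))))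
        (B.≤-reflexive (B.·-inverseʳ π (value a)))

      value-above : ∀ π → Fixes π L → ∀ a → value a B.≤ π B.· value (π ⁻¹ A.· a)
      value-above π fix a = value-least a _ λ n → B.≤-trans
        (B.≤-reflexive (B.sym (proj₂ c.support n π fix a)))
        (B.·-mono π (value-ub _ n))

      limit : Fun A B
      limit = record
        { _⟨$⟩_      = value
        ; monotone   = value-mono
        ; support    = L , λ π fix a → B.antisym (value-below π fix a) (value-above π fix a)
        ; continuous = λ d {a} (ub , least) → (λ m → value-mono (ub m)) , λ b b-ub →
            value-least a b λ n → proj₂ (Fun.continuous (c.seq n) d (ub , least)) b
              λ m → B.≤-trans (value-ub _ n) (b-ub m)
        }

  infixr 4 _⇒_

  _⇒_ : FMCpo → FMCpo → FMCpo
  A ⇒ B = record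
    { fmPoset = funPoset A B
    ; lub     = λ em c → Limit.limit A B em c ,
        (λ n a → Limit.value-ub A B em c a n) , λ g ub a → Limit.value-least A B em c a _ (λ n → ub n a)
    }

  data Val : Set where
    loc     : Loc → Val
    int     : ℤ → Val
    default : Val

  infixr 8 _·ᵛ_ _·ᶜ_

  _·ᵛ_ : Perm → Val → Val
  π ·ᵛ loc l   = loc (to π l)
  π ·ᵛ int i   = int i
  π ·ᵛ default = default

  _≟ᵛ_ : DecidableEquality Val
  loc k   ≟ᵛ loc l   = map′ (≡.cong loc) (λ { ≡.refl → ≡.refl }) (k ≟ₗ l)
  int i   ≟ᵛ int j   = map′ (≡.cong int) (λ { ≡.refl → ≡.refl }) (i ℤ.≟ j)
  default ≟ᵛ default = yes ≡.refl
  loc _   ≟ᵛ int _   = no λ ()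
  loc _   ≟ᵛ default = no λ ()
  int _   ≟ᵛ loc _   = no λ ()
  int _   ≟ᵛ default = no λ ()
  default ≟ᵛ loc _   = no λ ()
  default ≟ᵛ int _   = no λ ()

  Cell : Set
  Cell = Maybe (Val × Val)

  _≟ᶜ_ : DecidableEquality Cell
  _≟ᶜ_ = Maybe.≡-dec (Product.≡-dec _≟ᵛ_ _≟ᵛ_)

  _·ᶜ_ : Perm → Cell → Cell
  π ·ᶜ x = Maybe.map (Product.map (π ·ᵛ_) (π ·ᵛ_)) x

  ·ᵛ-cong : ∀ {π σ} → π ≈ₚ σ → ∀ v → π ·ᵛ v ≡ σ ·ᵛ v
  ·ᵛ-cong eq (loc l) = ≡.cong loc (eq l)
  ·ᵛ-cong eq (int i) = ≡.refl
  ·ᵛ-cong eq default = ≡.refl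

  ·ᵛ-id : ∀ v → idₚ ·ᵛ v ≡ v
  ·ᵛ-id (loc l) = ≡.refl
  ·ᵛ-id (int i) = ≡.refl
  ·ᵛ-id default = ≡.refl

  ·ᵛ-∘ : ∀ π σ v → π ·ᵛ σ ·ᵛ v ≡ (π ∘ₚ σ) ·ᵛ v
  ·ᵛ-∘ π σ (loc l) = ≡.refl
  ·ᵛ-∘ π σ (int i) = ≡.refl
  ·ᵛ-∘ π σ default = ≡.refl

  ·ᶜ-cong : ∀ {π σ} → π ≈ₚ σ → ∀ x → π ·ᶜ x ≡ σ ·ᶜ x
  ·ᶜ-cong {π} {σ} eq (just (v , w)) =
    ≡.cong₂ (λ v w → just (v , w)) (·ᵛ-cong {π} {σ} eq v) (·ᵛ-cong {π} {σ} eq w)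
  ·ᶜ-cong eq nothing = ≡.refl

  ·ᶜ-id : ∀ x → idₚ ·ᶜ x ≡ x
  ·ᶜ-id (just (v , w)) = ≡.cong₂ (λ v w → just (v , w)) (·ᵛ-id v) (·ᵛ-id w)
  ·ᶜ-id nothing        = ≡.refl

  ·ᶜ-∘ : ∀ π σ x → π ·ᶜ σ ·ᶜ x ≡ (π ∘ₚ σ) ·ᶜ x
  ·ᶜ-∘ π σ (just (v , w)) = ≡.cong₂ (λ v w → just (v , w)) (·ᵛ-∘ π σ v) (·ᵛ-∘ π σ w)
  ·ᶜ-∘ π σ nothing        = ≡.refl

  locsᵛ : Val → List Loc
  locsᵛ (loc l) = l ∷ []
  locsᵛ (int i) = []
  locsᵛ default = []

  locsᶜ : Cell → List Loc
  locsᶜ (just (v , w)) = locsᵛ v ++ locsᵛ w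
  locsᶜ nothing        = []

  supportedᵛ : ∀ π v → Fixes π (locsᵛ v) → π ·ᵛ v ≡ v
  supportedᵛ π (loc l) fix = ≡.cong loc (fix (here ≡.refl))
  supportedᵛ π (int i) fix = ≡.refl
  supportedᵛ π default fix = ≡.refl

  supportedᶜ : ∀ π x → Fixes π (locsᶜ x) → π ·ᶜ x ≡ x
  supportedᶜ π (just (v , w)) fix = ≡.cong₂ (λ v w → just (v , w))
    (supportedᵛ π v (fix ∘ ∈-++⁺ˡ)) (supportedᵛ π w (fix ∘ ∈-++⁺ʳ (locsᵛ v)))
  supportedᶜ π nothing        fix = ≡.refl

  record FinPartial : Set where
    field
      lookup : Loc → Cell

    infix 4 _∈dom

    _∈dom : Loc → Set
    l ∈dom = lookup l ≢ nothing

    field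
      finite : ∃[ L ] ∀ l → l ∈dom → l ∈ L

  open FinPartial using (lookup)

  infix 4 _∈dom_

  _∈dom_ : Loc → FinPartial → Set
  l ∈dom h = FinPartial._∈dom h l

  infix 4 _≈ʰ_

  record _≈ʰ_ (h h′ : FinPartial) : Set where
    constructor pointwise
    field
      at : ∀ l → lookup h l ≡ lookup h′ l

  open _≈ʰ_ using (at)

  infixr 8 _·ʰ_

  _·ʰ_ : Perm → FinPartial → FinPartial
  π ·ʰ h = record
    { lookup = λ l → π ·ᶜ lookup h (from π l)
    ; finite = map (to π) L , λ l l∈dom → ≡.subst (_∈ map (to π) L) (Perm.strictlyInverseˡ π l)
        (∈-map⁺ (to π) (⊆L (from π l) (l∈dom ∘ ≡.cong (π ·ᶜ_))))
    }
    where
    L  = proj₁ (FinPartial.finite h)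
    ⊆L = proj₂ (FinPartial.finite h)

  outside : ∀ h {l} → l ∉ proj₁ (FinPartial.finite h) → lookup h l ≡ nothing
  outside h {l} l∉L = decidable-stable (lookup h l ≟ᶜ nothing)
    (λ l∈dom → l∉L (proj₂ (FinPartial.finite h) l l∈dom))

  heapFMSet : FMSet
  heapFMSet = record
    { setoid′   = record
      { Carrier       = FinPartial
      ; _≈_           = _≈ʰ_
      ; isEquivalence = record
        { refl  = pointwise λ _ → ≡.refl
        ; sym   = λ eq → pointwise λ l → ≡.sym (at eq l)
        ; trans = λ eq eq′ → pointwise λ l → ≡.trans (at eq l) (at eq′ l)
        }
      }
    ; _·_       = _·ʰ_
    ; ·-cong    = λ {π} {σ} {h} {h′} π≈σ h≈h′ → pointwise λ l → ≡.trans
        (·ᶜ-cong {π} {σ} π≈σ (lookup h (from π l)))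
        (≡.cong (σ ·ᶜ_) (≡.trans (≡.cong (lookup h) (from-cong {π} {σ} π≈σ l)) (at h≈h′ (from σ l))))
    ; ·-id      = λ h → pointwise λ l → ·ᶜ-id (lookup h l)
    ; ·-∘       = λ π σ h → pointwise λ l → ·ᶜ-∘ π σ (lookup h (from σ (from π l)))
    ; supported = λ h → proj₁ (FinPartial.finite h)
                          ++ concatMap (locsᶜ ∘ lookup h) (proj₁ (FinPartial.finite h))
                      , λ π fix → pointwise (supports h π fix)
    }
    where
    supports : ∀ h π → Fixes π (proj₁ (FinPartial.finite h)
                                  ++ concatMap (locsᶜ ∘ lookup h) (proj₁ (FinPartial.finite h))) →
               ∀ l → lookup (π ·ʰ h) l ≡ lookup h l
    supports h π fix l with l ∈? proj₁ (FinPartial.finite h)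
      where open import Data.List.Membership.DecPropositional _≟ₗ_ using (_∈?_)
    ... | yes l∈L = ≡.trans
      (≡.cong (λ k → π ·ᶜ lookup h k) (Fixes-⁻¹ π (fix ∘ ∈-++⁺ˡ) l∈L))
      (supportedᶜ π (lookup h l) λ k∈ → fix
        (∈-++⁺ʳ (proj₁ (FinPartial.finite h)) (∈-concatMap⁺ (locsᶜ ∘ lookup h) (lose l∈L k∈))))
    ... | no l∉L = ≡.trans (≡.cong (π ·ᶜ_) (outside h from∉L)) (≡.sym (outside h l∉L))
      where
      from∉L : from π l ∉ proj₁ (FinPartial.finite h)
      from∉L ∈L = l∉L (≡.subst (_∈ _)
        (≡.trans (≡.sym (fix (∈-++⁺ˡ ∈L))) (Perm.strictlyInverseˡ π l)) ∈L)

  infix 4 _≟ʰ_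

  _≟ʰ_ : ∀ h h′ → Dec (h ≈ʰ h′)
  h ≟ʰ h′ = map′ toEq (λ eq → All.tabulate (λ {l} _ → at eq l))
                 (All.all? (λ l → lookup h l ≟ᶜ lookup h′ l) (L ++ M))
    where
    L = proj₁ (FinPartial.finite h)
    M = proj₁ (FinPartial.finite h′)
    toEq : All.All (λ l → lookup h l ≡ lookup h′ l) (L ++ M) → h ≈ʰ h′
    toEq all = pointwise λ l → decidable-stable (lookup h l ≟ᶜ lookup h′ l) λ ne →
      ne (≡.trans (outside h (ne ∘ All.lookup all ∘ ∈-++⁺ˡ))
                  (≡.sym (outside h′ (ne ∘ All.lookup all ∘ ∈-++⁺ʳ L))))

  infix 4 _≐_•_

  -- As the domains are disjoint, the left bias of _<∣>_ is immaterial.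
  _≐_•_ : FinPartial → FinPartial → FinPartial → Set
  h ≐ n • m = (∀ l → ¬ (l ∈dom n × l ∈dom m))
            × (∀ l → lookup h l ≡ (lookup n l <∣> lookup m l))

  data Outcome : Set where
    normal err : Outcome

  data Error : Set where
    err : Error

  O Heap HeapOrErr⊥ Cont : FMCpo
  O          = discrete (trivialAction Outcome) ⊥
  Heap       = discrete heapFMSet
  HeapOrErr⊥ = discrete (heapFMSet ⊎ᶠᵐ trivialAction Error) ⊥
  Cont       = Heap ⇒ O

  module O    = FMCpo O
  module Heap = FMCpo Heap

  discrete-continuous : ∀ A B (f : FMSet.Carrier A → ∣ B ∣) →
    (∀ {a b} → FMSet._≈_ A a b → FMCpo._≤_ B (f a) (f b)) →
    ∀ (c : FMCpo.Chain (discrete A)) {a} →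
    FMCpo.IsLub (discrete A) (FMCpo.Chain.seq {discrete A} c) a →
    FMCpo.IsLub B (f ∘ FMCpo.Chain.seq {discrete A} c) (f a)
  discrete-continuous A B f mono c (ub , _) =
    (λ n → mono (ub n)) , λ b b-ub → FMCpo.≤-trans B (mono (FMSet.sym A (ub 0))) (b-ub 0)

  -- The continuation equal to b at x and to k elsewhere.  It shows, without excluded
  -- middle, that least upper bounds in Cont are pointwise.
  module _ (k : ∣ Cont ∣) (x : ∣ Heap ∣) (b : ∣ O ∣) where
    private
      value : ∀ y → Dec (y ≈ʰ x) → ∣ O ∣
      value y (yes _) = b
      value y (no  _) = k ⟨$⟩ y

      value-cong : ∀ {y z} → y Heap.≈ z → (p : Dec (y ≈ʰ x)) (q : Dec (z ≈ʰ x)) →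
                   value y p O.≤ value z q
      value-cong y≈z (yes _)   (yes _)   = O.≤-refl
      value-cong y≈z (yes y≈x) (no z≉x)  = ⊥-elim (z≉x (Heap.trans (Heap.sym y≈z) y≈x))
      value-cong y≈z (no y≉x)  (yes z≈x) = ⊥-elim (y≉x (Heap.trans y≈z z≈x))
      value-cong y≈z (no _)    (no _)    = Fun.monotone k y≈z

      L M : List Loc
      L = proj₁ (Fun.support k)
      M = proj₁ (Heap.supported x)

      value-support : ∀ π → Fixes π (L ++ M) → ∀ y (p : Dec (π ⁻¹ ·ʰ y ≈ʰ x)) (q : Dec (y ≈ʰ x)) →
                      π O.· value (π ⁻¹ ·ʰ y) p O.≈ value y q
      value-support π fix y (yes _)  (yes _)  = O-trivial π b
        where
        O-trivial : ∀ (π : Perm) (o : ∣ O ∣) → π O.· o O.≈ o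
        O-trivial π ⊥₋    = O.refl
        O-trivial π [ _ ] = O.refl
      value-support π fix y (yes p)  (no y≉x) = ⊥-elim (y≉x (Heap.trans
        (Heap.sym (Heap.·-inverseʳ π y)) (Heap.trans
          (Heap.·-cong {π} {π} (λ _ → ≡.refl) p) (proj₂ (Heap.supported x) π (fix ∘ ∈-++⁺ʳ L)))))
      value-support π fix y (no ¬p)  (yes q)  = ⊥-elim (¬p (Heap.trans
        (Heap.·-cong {π ⁻¹} {π ⁻¹} (λ _ → ≡.refl) q)
        (proj₂ (Heap.supported x) (π ⁻¹) (Fixes-⁻¹ π (fix ∘ ∈-++⁺ʳ L)))))
      value-support π fix y (no _)   (no _)   = proj₂ (Fun.support k) π (fix ∘ ∈-++⁺ˡ) y

    update : ∣ Cont ∣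
    update = record
      { _⟨$⟩_      = λ y → value y (y ≟ʰ x)
      ; monotone   = λ {y} {z} y≈z → value-cong y≈z (y ≟ʰ x) (z ≟ʰ x)
      ; support    = L ++ M , λ π fix y → value-support π fix y (π ⁻¹ ·ʰ y ≟ʰ x) (y ≟ʰ x)
      ; continuous = discrete-continuous heapFMSet O (λ y → value y (y ≟ʰ x))
          (λ {y} {z} y≈z → value-cong y≈z (y ≟ʰ x) (z ≟ʰ x))
      }

    ≤-update : ∀ j → FMCpo._≤_ Cont j k → (j ⟨$⟩ x) O.≤ b → FMCpo._≤_ Cont j update
    ≤-update j j≤k jx≤b y with y ≟ʰ x
    ... | yes y≈x = O.≤-trans (Fun.monotone j y≈x) jx≤b
    ... | no  _   = j≤k y

    update-≤ : (update ⟨$⟩ x) O.≤ b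
    update-≤ with x ≟ʰ x
    ... | yes _  = O.≤-refl
    ... | no x≉x = ⊥-elim (x≉x Heap.refl)

  lub-pointwise : ∀ {c k} → FMCpo.IsLub Cont c k →
                  ∀ x b → (∀ n → (c n ⟨$⟩ x) O.≤ b) → (k ⟨$⟩ x) O.≤ b
  lub-pointwise {c} {k} (ub , least) x b b-ub = O.≤-trans
    (least (update k x b) (λ n → ≤-update k x b (c n) (ub n) (b-ub n)) x) (update-≤ k x b)

  module Cont = FMCpo Cont
  module HeapOrErr⊥ = FMCpo HeapOrErr⊥

  run : ∣ HeapOrErr⊥ ∣ → ∣ Cont ∣ → ∣ O ∣
  run ⊥₋           k = ⊥₋
  run [ inj₁ h ]   k = k ⟨$⟩ h
  run [ inj₂ err ] k = [ err ]

  run-mono : ∀ {x y j k} → x HeapOrErr⊥.≤ y → j Cont.≤ k → run x j O.≤ run y k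
  run-mono (LiftOrd.⊥₋≤ _)                       j≤k = LiftOrd.⊥₋≤ _
  run-mono {j = j} LiftOrd.[ inj₁ h≈h′ ]         j≤k = O.≤-trans (Fun.monotone j h≈h′) (j≤k _)
  run-mono {[ inj₂ err ]} {[ inj₂ err ]} LiftOrd.[ inj₂ _ ] j≤k = O.≤-refl

  run-cong : ∀ {x y j k} → x HeapOrErr⊥.≈ y → j Cont.≈ k → run x j O.≈ run y k
  run-cong {x} {y} {j} {k} x≈y j≈k = O.antisym
    (run-mono {x} {y} {j} {k} (HeapOrErr⊥.≤-reflexive x≈y) (Cont.≤-reflexive {j} {k} j≈k))
    (run-mono {y} {x} {k} {j} (HeapOrErr⊥.≤-reflexive (HeapOrErr⊥.sym x≈y))
      (Cont.≤-reflexive {k} {j} (Cont.sym {j} {k} j≈k)))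

  run-equivariant : ∀ π x k → π O.· run x k O.≈ run (π HeapOrErr⊥.· x) (π Cont.· k)
  run-equivariant π ⊥₋           k = O.refl
  run-equivariant π [ inj₁ h ]   k = O.·-cong {π} {π} (λ _ → ≡.refl)
    (Fun.fun-cong k (Heap.sym (Heap.·-inverseˡ π h)))
  run-equivariant π [ inj₂ err ] k = O.refl

  run-continuous : ∀ x {c k} → Cont.IsLub c k → ∀ b → (∀ n → run x (c n) O.≤ b) → run x k O.≤ b
  run-continuous ⊥₋                   isLub b ub = LiftOrd.⊥₋≤ b
  run-continuous [ inj₁ h ]   {c} {k} isLub b ub = lub-pointwise {c} {k} isLub h b ub
  run-continuous [ inj₂ err ]         isLub b ub = ub 0

  cps : ∣ Heap ⇒ HeapOrErr⊥ ∣ → ∣ Heap ×ᶠᵐ Cont ⇒ O ∣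
  cps c = record
    { _⟨$⟩_      = λ (h , k) → run (c ⟨$⟩ h) k
    ; monotone   = λ { {h , k} {h′ , k′} (h≈h′ , k≤k′) →
        run-mono {j = k} {k = k′} (c.monotone h≈h′) k≤k′ }
    ; support    = proj₁ c.support , λ π fix (h , k) →
        O.trans (run-equivariant π (c ⟨$⟩ (π ⁻¹ ·ʰ h)) (π ⁻¹ Cont.· k))
          (run-cong {j = π Cont.· π ⁻¹ Cont.· k} {k = k}
            (proj₂ c.support π fix h) (Cont.·-inverseʳ π k))
    ; continuous = continuous
    }
    where
    module c = Fun c
    module D = FMCpo (Heap ×ᶠᵐ Cont)

    f : D.Carrier → O.Carrier
    f (h , k) = run (c ⟨$⟩ h) k

    continuous : (d : D.Chain) → ∀ {hk} → D.IsLub (D.Chain.seq d) hk → O.IsLub (f ∘ D.Chain.seq d) (f hk)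
    continuous d {h , k} (ub , least) =
      (λ n → run-mono {j = kₙ n} {k = k} (c.monotone (proj₁ (ub n))) (proj₂ (ub n))) ,
      λ b b-ub → run-continuous (c ⟨$⟩ h) {kₙ} {k}
        (proj₂ ∘ ub , λ j j-ub → proj₂ (least (h , j) λ n → proj₁ (ub n) , j-ub n))
        b λ n → O.≤-trans
          (run-mono {j = kₙ n} {k = kₙ n} (c.monotone (Heap.sym (proj₁ (ub n)))) (Cont.≤-refl {kₙ n}))
          (b-ub n)
      where
      kₙ : ℕ → ∣ Cont ∣
      kₙ n = proj₂ (D.Chain.seq d n)

  -- respects is what makes rel a relation on heaps, whose equality is _≈ʰ_.
  record 𝓡 : Set₁ where
    field
      rel       : Rel ∣ Heap ∣ 0ℓ
      respects  : rel Respects₂ Heap._≈_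
      supported : ∃[ L ] ∀ π → Fixes π L → ∀ h₀ h₁ → rel h₀ h₁ ⇔ rel (π Heap.· h₀) (π Heap.· h₁)

  open 𝓡 using (rel)

  infixr 7 _*_

  _*_ : 𝓡 → 𝓡 → Rel ∣ Heap ∣ 0ℓ
  (r * s) h₀ h₁ = ∃[ n₀ ] ∃[ m₀ ] ∃[ n₁ ] ∃[ m₁ ]
    (h₀ ≐ n₀ • m₀) × (h₁ ≐ n₁ • m₁) × rel r n₀ n₁ × rel s m₀ m₁

  G : Pred ∣ O ∣ 0ℓ
  G o = (o O.≈ [ normal ]) ⊎ (o O.≈ ⊥₋)

  eq : ∀ D → Pred ∣ D ∣ 0ℓ → Rel ∣ D ∣ 0ℓ
  eq D D₀ d d′ = D₀ d × FMCpo._≈_ D d d′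

  infixr 6 _[→]_

  _[→]_ : ∀ {A B} → Rel ∣ A ∣ 0ℓ → Rel ∣ B ∣ 0ℓ → Rel ∣ A ⇒ B ∣ 0ℓ
  (r [→] s) k₀ k₁ = ∀ a₀ a₁ → r a₀ a₁ → s (k₀ ⟨$⟩ a₀) (k₁ ⟨$⟩ a₁)

  Quadruple : 𝓡 → (d₀ d₁ : ∣ Heap ×ᶠᵐ Cont ⇒ O ∣) → 𝓡 → Set₁
  Quadruple r d₀ d₁ s = ∀ (r′ : 𝓡) (h₀ h₁ : ∣ Heap ∣) (k₀ k₁ : ∣ Cont ∣) →
    (r * r′) h₀ h₁ → (_[→]_ {Heap} {O} (s * r′) (eq O G)) k₀ k₁ →
    eq O G (d₀ ⟨$⟩ (h₀ , k₀)) (d₁ ⟨$⟩ (h₁ , k₁))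

  module _ {D : FMCpo} where

    infix 9 _^⊥ _^⊥⊥

    _^⊥ : Rel ∣ D ∣ 0ℓ → Rel ∣ D ⇒ O ∣ 0ℓ
    (r ^⊥) k₁ k₂ = ∀ d₁ d₂ → r d₁ d₂ → eq O G (k₁ ⟨$⟩ d₁) (k₂ ⟨$⟩ d₂)

    _^⊥⊥ : Rel ∣ D ∣ 0ℓ → Rel ∣ D ∣ 0ℓ
    (r ^⊥⊥) d₁ d₂ = ∀ (k₁ k₂ : ∣ D ⇒ O ∣) → (r ^⊥) k₁ k₂ → eq O G (k₁ ⟨$⟩ d₁) (k₂ ⟨$⟩ d₂)

  -- A relation on Heap, read as a relation on (Heap + {err})_⊥ along the inclusion; related
  -- elements are in particular both heaps.
  OnHeaps : Rel ∣ Heap ∣ 0ℓ → Rel ∣ HeapOrErr⊥ ∣ 0ℓ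
  OnHeaps R x₁ x₂ = ∃[ h₁ ] ∃[ h₂ ]
    (x₁ HeapOrErr⊥.≈ [ inj₁ h₁ ]) × (x₂ HeapOrErr⊥.≈ [ inj₁ h₂ ]) × R h₁ h₂

{-# OPTIONS --safe #-}
-- Both sides speak about the results c₁(h₁) and c₂(h₂) only, so the quadruple reduces to a
-- fact about two results of (Heap + {err})_⊥ run against all continuations related by R^⊥.
-- The constantly normal continuation is R^⊥-related to itself; running against it rules out
-- err, which lies outside G, and tells ⊥ apart from a heap.
module Submission where

open import Defs using (module Semantics)
open import Data.List.Base using ([])
open import Data.Nat.Base using (ℕ)
open import Data.Product.Base using (_×_; _,_)
open import Data.Sum.Base using (_⊎_; inj₁; inj₂)
open import Function.Bundles using (_↔_; _⇔_; mk⇔)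
open import Level using (0ℓ)
open import Relation.Binary.Core using (Rel)
open import Relation.Binary.Construct.Add.Infimum.Equality using (⊥₋≈⊥₋; [_])
open import Relation.Nullary.Construct.Add.Infimum using (⊥₋) renaming ([_] to [_]₋)

module _ (Loc : Set) (Loc↔ℕ : Loc ↔ ℕ) where
  open Semantics Loc Loc↔ℕ

  -- The empty support works because permutations fix every element of `O`; the action computes only
  -- after the case split in `trivial`.
  const : ∀ A → ∣ O ∣ → ∣ discrete A ⇒ O ∣
  const A o = record
    { _⟨$⟩_      = λ _ → o
    ; monotone   = λ _ → O.≤-refl
    ; support    = [] , λ π _ _ → trivial π o
    ; continuous = discrete-continuous A O (λ _ → o) (λ _ → O.≤-refl)
    }
    where
    trivial : ∀ π o → π O.· o O.≈ o
    trivial π ⊥₋     = O.refl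
    trivial π [ _ ]₋ = O.refl

  -- With `run-cong`, this lets a result known only up to setoid equality be replaced by a
  -- representative on which `run` computes.
  eq-resp : ∀ {a a′ b b′} → a O.≈ a′ → b O.≈ b′ → eq O G a b → eq O G a′ b′
  eq-resp {a} {a′} {b} {b′} a≈a′ b≈b′ (a∈G , a≈b) =
    G-resp a∈G , O.trans {a′} {b} {b′} (O.trans {a′} {a} {b} (O.sym {a} {a′} a≈a′) a≈b) b≈b′
    where
    G-resp : G a → G a′
    G-resp (inj₁ a≈normal) = inj₁ (O.trans {a′} {a} {[ normal ]₋} (O.sym {a} {a′} a≈a′) a≈normal)
    G-resp (inj₂ a≈⊥)      = inj₂ (O.trans {a′} {a} {⊥₋} (O.sym {a} {a′} a≈a′) a≈⊥)

  module _ (R : Rel ∣ Heap ∣ 0ℓ) where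

    -- With `R = s * r′` this is the demand of `Quadruple` on two results: `cps` unfolds to `run`,
    -- and `R ^⊥` is `R [→] eq O G` unfolded.
    RunsRelated : Rel ∣ HeapOrErr⊥ ∣ 0ℓ
    RunsRelated x₁ x₂ = ∀ k₁ k₂ → (_^⊥ {Heap} R) k₁ k₂ → eq O G (run x₁ k₁) (run x₂ k₂)

    BothDivergeOrOnHeaps : Rel ∣ HeapOrErr⊥ ∣ 0ℓ
    BothDivergeOrOnHeaps x₁ x₂ =
      (x₁ HeapOrErr⊥.≈ ⊥₋ × x₂ HeapOrErr⊥.≈ ⊥₋) ⊎ OnHeaps (_^⊥⊥ {Heap} R) x₁ x₂

    run-const-normal : ∀ x₁ x₂ → RunsRelated x₁ x₂ →
      let k = const heapFMSet [ normal ]₋ in eq O G (run x₁ k) (run x₂ k)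
    run-const-normal x₁ x₂ rel = rel k k (λ _ _ _ → inj₁ O.refl , O.refl)
      where k = const heapFMSet [ normal ]₋

    runsRelated⇒ : ∀ x₁ x₂ → RunsRelated x₁ x₂ → BothDivergeOrOnHeaps x₁ x₂
    runsRelated⇒ ⊥₋ ⊥₋ rel = inj₁ (⊥₋≈⊥₋ , ⊥₋≈⊥₋)
    -- On heaps `run` is application, so `rel` is itself the proof of `R ^⊥⊥`.
    runsRelated⇒ [ inj₁ h₁ ]₋ [ inj₁ h₂ ]₋ rel =
      inj₂ (h₁ , h₂ , HeapOrErr⊥.refl , HeapOrErr⊥.refl , rel)
    -- `eq` puts only its first component in `G`, so an error on the left contradicts membership,
    -- whatever `x₂` is. In all later cases the equality of the two outcomes fails.
    runsRelated⇒ x₁@([ inj₂ err ]₋) x₂ rel with run-const-normal x₁ x₂ rel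
    ... | inj₁ [ () ] , _
    ... | inj₂ ()     , _
    runsRelated⇒ x₁@([ inj₁ _ ]₋) x₂@([ inj₂ err ]₋) rel with run-const-normal x₁ x₂ rel
    ... | _ , [ () ]
    runsRelated⇒ x₁@([ inj₁ _ ]₋) x₂@⊥₋ rel with run-const-normal x₁ x₂ rel
    ... | _ , ()
    runsRelated⇒ x₁@⊥₋ x₂@([ inj₁ _ ]₋) rel with run-const-normal x₁ x₂ rel
    ... | _ , ()
    runsRelated⇒ x₁@⊥₋ x₂@([ inj₂ err ]₋) rel with run-const-normal x₁ x₂ rel
    ... | _ , ()

    runsRelated⇐ : ∀ x₁ x₂ → BothDivergeOrOnHeaps x₁ x₂ → RunsRelated x₁ x₂
    -- The relation between the continuations is not consulted: `run ⊥₋` ignores its continuation,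
    -- and `⊥₋` lies in `G`.
    runsRelated⇐ x₁ x₂ (inj₁ (x₁≈⊥ , x₂≈⊥)) k₁ k₂ _ = eq-resp
      (run-cong {⊥₋} {x₁} {k₁} {k₁} (HeapOrErr⊥.sym x₁≈⊥) (Cont.refl {k₁}))
      (run-cong {⊥₋} {x₂} {k₂} {k₂} (HeapOrErr⊥.sym x₂≈⊥) (Cont.refl {k₂}))
      (inj₂ O.refl , O.refl)
    runsRelated⇐ x₁ x₂ (inj₂ (h₁ , h₂ , x₁≈h₁ , x₂≈h₂ , h₁Rh₂)) k₁ k₂ k₁Rk₂ = eq-resp
      (run-cong {[ inj₁ h₁ ]₋} {x₁} {k₁} {k₁} (HeapOrErr⊥.sym x₁≈h₁) (Cont.refl {k₁}))
      (run-cong {[ inj₁ h₂ ]₋} {x₂} {k₂} {k₂} (HeapOrErr⊥.sym x₂≈h₂) (Cont.refl {k₂}))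
      (h₁Rh₂ k₁ k₂ k₁Rk₂)

proposition7p2 : ∀ (Loc : Set) (Loc↔ℕ : Loc ↔ ℕ) →
    let open Semantics Loc Loc↔ℕ in
    (r s : 𝓡) (c₁ c₂ : ∣ Heap ⇒ HeapOrErr⊥ ∣) →
    Quadruple r (cps c₁) (cps c₂) s
    ⇔
    (∀ (r′ : 𝓡) (h₁ h₂ : ∣ Heap ∣) → (r * r′) h₁ h₂ →
    ((c₁ ⟨$⟩ h₁) HeapOrErr⊥.≈ ⊥₋ × (c₂ ⟨$⟩ h₂) HeapOrErr⊥.≈ ⊥₋)
    ⊎ OnHeaps (_^⊥⊥ {Heap} (s * r′)) (c₁ ⟨$⟩ h₁) (c₂ ⟨$⟩ h₂))
proposition7p2 Loc Loc↔ℕ r s c₁ c₂ = mk⇔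
  -- The equivalence holds separately for each `r′` and each related pair of heaps; only the order
  -- of arguments changes.
  (λ quadruple r′ h₁ h₂ h₁∼h₂ → runsRelated⇒ Loc Loc↔ℕ (s * r′) (c₁ ⟨$⟩ h₁) (c₂ ⟨$⟩ h₂)
    (λ k₁ k₂ → quadruple r′ h₁ h₂ k₁ k₂ h₁∼h₂))
  (λ results r′ h₁ h₂ k₁ k₂ h₁∼h₂ → runsRelated⇐ Loc Loc↔ℕ (s * r′) (c₁ ⟨$⟩ h₁) (c₂ ⟨$⟩ h₂)
    (results r′ h₁ h₂ h₁∼h₂) k₁ k₂)
  where open Semantics Loc Loc↔ℕ
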